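{- Let $\mathcal{S}$ denote the class of all graphs having the strong Havel--Hakimi property. Then $$\mathcal{S} = \operatorname{Forb}(\{P_5,\ \text{4-pan},\ K_{2,3},\ K_{2,3}^+,\ \text{kite},\ 2P_3,\ P_3+K_3,\ \text{stool},\ \text{co-domino}\}).$$ That is, a graph $G$ has the strong Havel--Hakimi property if and only if no induced subgraph of $G$ is isomorphic to one of these nine graphs.
   Context: All graphs are finite and simple. A vertex $v$ of a graph $G$ has the Havel--Hakimi property (in $G$) if $v$ has maximum degree in $G$ and no vertex adjacent to $v$ has degree smaller than that of some vertex not adjacent to $v$; that is, $d_G(w)\ge d_G(u)$ for every neighbor $w$ of $v$ and every vertex $u\neq v$ not adjacent to $v$. A graph $G$ has the strong Havel--Hakimi property if in every induced subgraph $H$ of $G$, every vertex of maximum degree in $H$ has the Havel--Hakimi property in $H$. For a class $\mathcal{F}$ of graphs, $\operatorname{Forb}(\mathcal{F})$ is the class of all graphs having no induced subgraph isomorphic to an element of $\mathcal{F}$. Notation for graphs: $G+H$ is the disjoint union of $G$ and $H$, and $mG$ is the disjoint union of $m$ copies of $G$. $P_n$ is the path on $n$ vertices, $K_n$ the complete graph on $n$ vertices, and $K_{m,n}$ the complete bipartite graph with partite sets of sizes $m$ and $n$. $K_{2,3}^+$ is the graph obtained from $K_{2,3}$ by adding one edge joining two vertices of the partite set of size 3 (equivalently, the complement of $K_2+P_3$). The remaining graphs are: - 4-pan: 5 vertices; a 4-cycle together with one further vertex adjacent to exactly one vertex of the cycle. - kite: 5 vertices; the graph obtained from $K_4$ minus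 an edge by adding one new vertex adjacent to exactly one of the two vertices of degree 2. Explicitly, vertices $a,b,c,p,d$ and edges $ab, bc, pa, pb, pc, cd$. - stool: 6 vertices $u,x,y,v,w,z$ and edges $ux, uy, xy, xv, vw, vz$ (a triangle $uxy$, with $x$ joined to a vertex $v$ that has two pendant neighbors $w,z$). - co-domino: 6 vertices $u,x,y,v,w,z$ and edges $ux, uy, xy, vw, vz, wz, xv, yz$ (two disjoint triangles joined by two disjoint edges; the complement of the graph obtained from a 6-cycle by adding a chord joining two opposite vertices). -}

module Defs where

open import Level using (0ℓ)
open import Data.Bool using (Bool; true; false; _∧_; _∨_; not; T)
open import Data.Bool.Properties using (∨-comm)
open import Data.Fin using (Fin; toℕ; splitAt; #_; _≟_)
open import Data.Fin.Subset using (Subset; ∣_∣)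
open import Data.List using (List; []; _∷_)
import Data.List.Membership.DecPropositional as DecMembership
open import Data.Nat as ℕ using (ℕ; suc; _≤_)
open import Data.Product using (Σ-syntax; ∃-syntax; _×_; _,_)
import Data.Product.Properties as Product
open import Data.Sum using (_⊎_; inj₁; inj₂)
open import Data.Vec using (tabulate)
open import Function.Bundles using (_↣_; _↔_; Injection; Inverse)
open import Relation.Binary.PropositionalEquality using (_≡_; _≢_; refl; sym; cong; cong₂)
open import Relation.Nullary using (¬_; yes; no; does; contradiction)
open import Relation.Unary using (Pred)

record Graph : Set where
  field
    order      : ℕ
    adj        : Fin order → Fin order → Bool
    adj-sym    : ∀ i j → adj i j ≡ adj j i
    adj-irrefl : ∀ i → adj i i ≡ false

open Graph public

V : Graph → Set
V G = Fin (order G)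

Adj : (G : Graph) → V G → V G → Set
Adj G u v = T (adj G u v)

neighbourhood : (G : Graph) → V G → Subset (order G)
neighbourhood G v = tabulate (adj G v)

degree : (G : Graph) → V G → ℕ
degree G v = ∣ neighbourhood G v ∣

-- The subgraph of G induced on the image of f, with vertices renamed along f.
-- Every vertex subset of G is the image of such an f for a suitable m.
induced : (G : Graph) {m : ℕ} → Fin m ↣ V G → Graph
induced G {m} f = record
  { order      = m
  ; adj        = λ i j → adj G (to i) (to j)
  ; adj-sym    = λ i j → adj-sym G (to i) (to j)
  ; adj-irrefl = λ i → adj-irrefl G (to i)
  }
  where open Injection f using (to)

_≅_ : Graph → Graph → Set
G ≅ H = Σ[ φ ∈ (V G ↔ V H) ]
  (∀ i j → adj G i j ≡ adj H (Inverse.to φ i) (Inverse.to φ j))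

MaxDegree : (G : Graph) → V G → Set
MaxDegree G v = ∀ u → degree G u ≤ degree G v

HavelHakimi : (G : Graph) → V G → Set
HavelHakimi G v =
  MaxDegree G v ×
  (∀ w u → Adj G v w → u ≢ v → ¬ Adj G v u → degree G u ≤ degree G w)

StrongHavelHakimi : Pred Graph 0ℓ
StrongHavelHakimi G =
  ∀ {m} (f : Fin m ↣ V G) (v : V (induced G f)) →
  MaxDegree (induced G f) v → HavelHakimi (induced G f) v

Forb : Pred Graph 0ℓ → Pred Graph 0ℓ
Forb 𝓕 G = ∀ F → 𝓕 F → ¬ (∃[ m ] Σ[ f ∈ (Fin m ↣ V G) ] induced G f ≅ F)

-- The simple graph underlying an arbitrary relation: orientation is
-- forgotten and loops are discarded.
fromRel : ∀ n → (Fin n → Fin n → Bool) → Graph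
fromRel n r = record
  { order      = n
  ; adj        = λ i j → not (does (i ≟ j)) ∧ (r i j ∨ r j i)
  ; adj-sym    = λ i j → cong₂ _∧_ (cong not (≟-sym i j)) (∨-comm (r i j) (r j i))
  ; adj-irrefl = irr
  }
  where
  ≟-sym : ∀ i j → does (i ≟ j) ≡ does (j ≟ i)
  ≟-sym i j with i ≟ j | j ≟ i
  ... | yes _ | yes _ = refl
  ... | no  _ | no  _ = refl
  ... | yes p | no ¬q = contradiction (sym p) ¬q
  ... | no ¬p | yes q = contradiction (sym q) ¬p

  irr : ∀ i → not (does (i ≟ i)) ∧ (r i i ∨ r i i) ≡ false
  irr i with i ≟ i
  ... | yes _ = refl
  ... | no ¬p = contradiction refl ¬p

fromEdges : ∀ n → List (Fin n × Fin n) → Graph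
fromEdges n es = fromRel n (λ i j → does ((i , j) ∈? es))
  where open DecMembership (Product.≡-dec (_≟_ {n}) (_≟_ {n})) using (_∈?_)

path : ℕ → Graph
path n = fromRel n (λ i j → does (toℕ j ℕ.≟ suc (toℕ i)))

complete : ℕ → Graph
complete n = fromRel n (λ _ _ → true)

-- The first m vertices form one partite set, the last n the other.
completeBipartite : ℕ → ℕ → Graph
completeBipartite m n = fromRel (m ℕ.+ n) (λ i j → r (splitAt m i) (splitAt m j))
  where
  r : Fin m ⊎ Fin n → Fin m ⊎ Fin n → Bool
  r (inj₁ _) (inj₂ _) = true
  r _        _        = false

infixl 6 _⊎ᴳ_

_⊎ᴳ_ : Graph → Graph → Graph
G ⊎ᴳ H = record
  { order      = order G ℕ.+ order H
  ; adj        = λ i j → a (splitAt (order G) i) (splitAt (order G) j)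
  ; adj-sym    = λ i j → a-sym (splitAt (order G) i) (splitAt (order G) j)
  ; adj-irrefl = λ i → a-irrefl (splitAt (order G) i)
  }
  where
  a : V G ⊎ V H → V G ⊎ V H → Bool
  a (inj₁ i) (inj₁ j) = adj G i j
  a (inj₂ i) (inj₂ j) = adj H i j
  a _        _        = false

  a-sym : ∀ x y → a x y ≡ a y x
  a-sym (inj₁ i) (inj₁ j) = adj-sym G i j
  a-sym (inj₁ _) (inj₂ _) = refl
  a-sym (inj₂ _) (inj₁ _) = refl
  a-sym (inj₂ i) (inj₂ j) = adj-sym H i j

  a-irrefl : ∀ x → a x x ≡ false
  a-irrefl (inj₁ i) = adj-irrefl G i
  a-irrefl (inj₂ i) = adj-irrefl H i

addEdge : (G : Graph) → V G → V G → Graph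
addEdge G u v =
  fromRel (order G) (λ i j → adj G i j ∨ (does (i ≟ u) ∧ does (j ≟ v)))

P₅ K₂,₃ K₂,₃⁺ 2P₃ P₃+K₃ 4-pan kite stool co-domino : Graph

P₅ = path 5

K₂,₃ = completeBipartite 2 3

-- 2, 3, 4 are the vertices of the partite set of size 3.
K₂,₃⁺ = addEdge K₂,₃ (# 2) (# 3)

2P₃ = path 3 ⊎ᴳ path 3

P₃+K₃ = path 3 ⊎ᴳ complete 3

-- The 4-cycle 0 1 2 3 with 4 pendant at 0.
4-pan = fromEdges 5
  ( (# 0 , # 1) ∷ (# 1 , # 2) ∷ (# 2 , # 3) ∷ (# 3 , # 0)
  ∷ (# 0 , # 4) ∷ [])

-- K₄ minus the edge ac, with d pendant at c.
kite = fromEdges 5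
  ((a , b) ∷ (b , c) ∷ (p , a) ∷ (p , b) ∷ (p , c) ∷ (c , d) ∷ [])
  where
  a b c p d : Fin 5
  a = # 0
  b = # 1
  c = # 2
  p = # 3
  d = # 4

stool = fromEdges 6
  ((u , x) ∷ (u , y) ∷ (x , y) ∷ (x , v) ∷ (v , w) ∷ (v , z) ∷ [])
  where
  u x y v w z : Fin 6
  u = # 0
  x = # 1
  y = # 2
  v = # 3
  w = # 4
  z = # 5

-- The triangles uxy and vwz joined by the edges xv and yz.
co-domino = fromEdges 6
  ( (u , x) ∷ (u , y) ∷ (x , y) ∷ (v , w) ∷ (v , z) ∷ (w , z)
  ∷ (x , v) ∷ (y , z) ∷ [])
  where
  u x y v w z : Fin 6
  u = # 0
  x = # 1
  y = # 2
  v = # 3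
  w = # 4
  z = # 5

forbidden : List Graph
forbidden =
  P₅ ∷ 4-pan ∷ K₂,₃ ∷ K₂,₃⁺ ∷ kite ∷ 2P₃ ∷ P₃+K₃ ∷ stool ∷ co-domino ∷ []

{-# OPTIONS --safe #-}
module Submission where

open import Defs
open import Data.Bool using (Bool; true; false; T; if_then_else_)
open import Data.Bool.Properties using (T-≡; T?; ¬-not)
open import Data.Empty using (⊥)
open import Data.Fin using (Fin; _≟_) renaming (zero to fzero; suc to fsuc)
open import Data.Fin.Properties using (all?; any?)
open import Data.Fin.Subset using (∣_∣)
open import Data.List using (List; []; _∷_; map)
open import Data.List.Membership.Propositional using (_∈_)
open import Data.List.Properties using (map-cong-local)
open import Data.List.Relation.Unary.All as All using (All; []; _∷_)
open import Data.List.Relation.Unary.AllPairs using ([]; _∷_)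
open import Data.List.Relation.Unary.Any using (here; there)
open import Data.List.Relation.Unary.Unique.Propositional using (Unique)
open import Data.Nat as ℕ using (ℕ; zero; suc; _+_; _≤_; _<_; s≤s)
open import Data.Nat.ListAction using () renaming (sum to sumᴸ)
open import Data.Nat.Properties as ℕ using (+-0-commutativeMonoid)
open import Algebra.Properties.CommutativeMonoid.Sum +-0-commutativeMonoid
  using (sum; ∑-distrib-+)
open import Algebra.Properties.CommutativeSemigroup ℕ.+-commutativeSemigroup
  using (interchange; x∙yz≈y∙xz)
open import Data.Product using (∃-syntax; Σ-syntax; _×_; _,_; proj₂)
open import Data.Vec using (Vec; []; _∷_; tabulate; lookup)
open import Data.Vec.Properties using (tabulate-cong)
open import Data.Vec.Functional using (Vector; updateAt)
open import Data.Vec.Functional.Properties using (updateAt-updates; updateAt-minimal)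
open import Data.Vec.Relation.Binary.Pointwise.Inductive
  using (Pointwise; []; _∷_)
open import Function using (_∘_; const; _∋_)
open import Function.Bundles using (_↣_; Inverse; Equivalence; mk↣)
open import Function.Construct.Composition using (_↣-∘_)
open import Function.Construct.Identity using (↔-id)
open import Function.Construct.Symmetry using (↔-sym)
open import Function.Properties.Inverse using (↔⇒↣)
open import Relation.Binary.PropositionalEquality
open import Relation.Nullary using (¬_; Dec; yes; no; contradiction; ¬?; _×-dec_)
open import Relation.Nullary.Decidable using (from-yes)
open import Relation.Unary using (_≐_)

-- Each forbidden graph is checked to have a maximum-degree vertex without the Havel–Hakimi property.
-- Conversely, let v have maximum degree, v ~ w, v ≁ u ≠ v and d(u) > d(w).  Write UV for the set of
-- vertices adjacent to u and v but not to w, and similarly U, V and UVW.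
-- If there is x ∈ UV, then d(v) + d(u) > d(x) + d(w) yields a further vertex t with more adjacencies
-- among v, u than among x, w; each possible type of t gives a forbidden subgraph on v, u, w, x, t,
-- when u ≁ w with the help of some y ∈ U.
-- If UV = ∅, then d(u) > d(w) yields two vertices of U and d(v) > d(w) yields one of V, and these
-- together with v, u, w contain a forbidden subgraph.

-- Sums of natural numbers compared away from given indices.

𝟙 : Bool → ℕ
𝟙 b = if b then 1 else 0

∣tabulate∣≡sum : ∀ {n} (p : Fin n → Bool) → ∣ tabulate p ∣ ≡ sum (𝟙 ∘ p)
∣tabulate∣≡sum {zero}  p = refl
∣tabulate∣≡sum {suc n} p with p fzero
... | true  = cong suc (∣tabulate∣≡sum (p ∘ fsuc))
... | false = ∣tabulate∣≡sum (p ∘ fsuc)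

sum-updateAt-0 : ∀ {n} (f : Vector ℕ n) i → sum f ≡ f i + sum (updateAt f i (const 0))
sum-updateAt-0 f fzero    = refl
sum-updateAt-0 f (fsuc i) = begin
  f fzero + sum (f ∘ fsuc)          ≡⟨ cong (f fzero +_) (sum-updateAt-0 (f ∘ fsuc) i) ⟩
  f fzero + (f (fsuc i) + s)        ≡⟨ x∙yz≈y∙xz (f fzero) (f (fsuc i)) s ⟩
  f (fsuc i) + (f fzero + s)        ∎
  where
  open ≡-Reasoning
  s = sum (updateAt (f ∘ fsuc) i (const 0))

sum-<⇒∃-< : ∀ {n} (f g : Vector ℕ n) → sum f < sum g → ∃[ i ] f i < g i
sum-<⇒∃-< {suc n} f g lt with f fzero ℕ.<? g fzero
... | yes f₀<g₀ = fzero , f₀<g₀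
... | no  f₀≮g₀ with sum-<⇒∃-< (f ∘ fsuc) (g ∘ fsuc)
                      (ℕ.≰⇒> λ le → ℕ.<⇒≱ lt (ℕ.+-mono-≤ (ℕ.≮⇒≥ f₀≮g₀) le))
...   | i , fᵢ<gᵢ = fsuc i , fᵢ<gᵢ

-- The hypothesis says that `f` sums to less than `g` off `is`, rearranged to avoid subtraction. The
-- induction erases `a` from both functions: each side loses `f a + g a`, and as `a` does not recur,
-- the rest of the list is unaffected.
exchange-outside : ∀ {n} (f g : Vector ℕ n) {is} → Unique is →
                   sumᴸ (map g is) + sum f < sumᴸ (map f is) + sum g →
                   ∃[ i ] All (i ≢_) is × f i < g i
exchange-outside f g [] lt with i , lt′ ← sum-<⇒∃-< f g lt = i , [] , lt′
exchange-outside f g {a ∷ is} (a∉is ∷ is!) lt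
  with exchange-outside (erase f) (erase g) is! lt′
  where
  erase = λ h → updateAt h a (const 0)
  unerased : ∀ h → sumᴸ (map (erase h) is) ≡ sumᴸ (map h is)
  unerased h = cong sumᴸ (map-cong-local
    (All.map (λ a≢i → updateAt-minimal _ a h (a≢i ∘ sym)) a∉is))
  split : ∀ h k → sumᴸ (map h (a ∷ is)) + sum k ≡
                  (h a + k a) + (sumᴸ (map (erase h) is) + sum (erase k))
  split h k = trans (cong₂ (λ s t → (h a + s) + t) (sym (unerased h)) (sum-updateAt-0 k a))
                    (interchange (h a) _ (k a) _)
  lt′ : sumᴸ (map (erase g) is) + sum (erase f) < sumᴸ (map (erase f) is) + sum (erase g)
  lt′ = ℕ.+-cancelˡ-< (g a + f a) _ _ (subst₂ _<_ (split g f)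
    (trans (split f g) (cong (_+ (sumᴸ (map (erase f) is) + sum (erase g))) (ℕ.+-comm (f a) (g a)))) lt)
... | i , i∉is , lt″ with i ≟ a
-- Both erased functions are 0 at `a`, so neither can be smaller there.
...   | yes refl = contradiction
          (subst₂ _<_ (updateAt-updates i f) (updateAt-updates i g) lt″) (ℕ.n≮n 0)
...   | no i≢a = i , i≢a ∷ i∉is ,
          subst₂ _<_ (updateAt-minimal i a f i≢a) (updateAt-minimal i a g i≢a) lt″

-- Opaque because with-abstraction over its uses would otherwise unfold the proof.
opaque
  sum-<⇒∃-<-outside : ∀ {n} (f g : Vector ℕ n) {is : List (Fin n)} → Unique is →
                      sumᴸ (map g is) ≤ sumᴸ (map f is) → sum f < sum g →
                      ∃[ i ] All (i ≢_) is × f i < g i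
  sum-<⇒∃-<-outside f g is! le lt = exchange-outside f g is! (ℕ.+-mono-≤-< le lt)

degree≡sum : ∀ G v → degree G v ≡ sum (𝟙 ∘ adj G v)
degree≡sum G v = ∣tabulate∣≡sum (adj G v)

-- Strong graphs contain none of the nine graphs.

FailsHavelHakimi : Graph → Set
FailsHavelHakimi F = ∃[ v ] MaxDegree F v × ∃[ w ] Adj F v w ×
  ∃[ u ] u ≢ v × ¬ Adj F v u × degree F w < degree F u

failsHavelHakimi? : ∀ F → Dec (FailsHavelHakimi F)
failsHavelHakimi? F = any? λ v →
  all? (λ u → degree F u ℕ.≤? degree F v) ×-dec any? λ w → T? (adj F v w) ×-dec
  any? λ u → ¬? (u ≟ v) ×-dec ¬? (T? (adj F v u)) ×-dec (degree F w ℕ.<? degree F u)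

forbidden-fail : All FailsHavelHakimi forbidden
forbidden-fail = from-yes (All.all? failsHavelHakimi? forbidden)

Contains : Graph → Graph → Set
Contains G F = ∃[ m ] Σ[ f ∈ (Fin m ↣ V G) ] induced G f ≅ F

-- Composing with the inverse isomorphism embeds `F` under its own vertex names, so adjacencies and
-- degrees agree and the failing triple carries over unchanged.
strong⇒¬contains : ∀ {G F} → StrongHavelHakimi G → FailsHavelHakimi F → ¬ Contains G F
strong⇒¬contains {G} {F} strong (v , v-max , w , v~w , u , u≢v , v≁u , d<d) (_ , f , φ , φ-adj) =
  ℕ.<⇒≱ d<d (subst₂ _≤_ (deg u) (deg w)
    (proj₂ (strong ψ v (λ t → subst₂ _≤_ (sym (deg t)) (sym (deg v)) (v-max t)))
      w u (subst T (sym (same v w)) v~w) u≢v (v≁u ∘ subst T (same v u))))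
  where
  ψ : V F ↣ V G
  ψ = f ↣-∘ ↔⇒↣ (↔-sym φ)
  same : ∀ i j → adj (induced G ψ) i j ≡ adj F i j
  same i j = trans (φ-adj _ _) (cong₂ (adj F) (Inverse.strictlyInverseˡ φ i) (Inverse.strictlyInverseˡ φ j))
  deg : ∀ i → degree (induced G ψ) i ≡ degree F i
  deg i = cong ∣_∣ (tabulate-cong (same i))

-- Exhibiting induced copies of small graphs.

-- Distinctness is stored because non-adjacency does not imply it and embeddings need it. The index
-- `b` lets `u ~ w` and `u ≁ w` be treated together where possible.
record Link (G : Graph) (b : Bool) (u v : V G) : Set where
  constructor link
  field
    distinct  : u ≢ v
    adjacency : adj G u v ≡ b

open Link

-- One row per vertex, listing only the adjacencies strictly above the diagonal.
data Realises (G : Graph) : ∀ {n} → (Fin n → Fin n → Bool) → Vec (V G) n → Set where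
  []  : ∀ {a} → Realises G a []
  _∷_ : ∀ {n x} {xs : Vec (V G) n} {a} →
        Pointwise (λ b y → Link G b x y) (tabulate (a fzero ∘ fsuc)) xs →
        Realises G (λ i j → a (fsuc i) (fsuc j)) xs → Realises G a (x ∷ xs)

module _ {G : Graph} where

  infix 9 _ᵒ
  _ᵒ : ∀ {b u v} → Link G b u v → Link G b v u
  link u≢v eq ᵒ = link (u≢v ∘ sym) (trans (adj-sym G _ _) eq)

  separated : ∀ {a b c} → Link G true c a → Link G false c b → a ≢ b
  separated ca cb refl = contradiction (trans (sym (adjacency ca)) (adjacency cb)) λ ()

  adjacent⇒link : ∀ {a b} → adj G a b ≡ true → Link G true a b
  adjacent⇒link {a} ab =
    link (λ { refl → contradiction (trans (sym ab) (adj-irrefl G a)) λ () }) ab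

  Pointwise-Link : ∀ {n x} {xs : Vec (V G) n} {a : Fin n → Bool} →
                   Pointwise (λ b y → Link G b x y) (tabulate a) xs →
                   ∀ i → Link G (a i) x (lookup xs i)
  Pointwise-Link (p ∷ ps) fzero    = p
  Pointwise-Link (p ∷ ps) (fsuc i) = Pointwise-Link ps i

  Realises-Link : ∀ {n a} {xs : Vec (V G) n} → Realises G a xs →
                  (∀ i j → a i j ≡ a j i) →
                  ∀ i j → i ≢ j → Link G (a i j) (lookup xs i) (lookup xs j)
  Realises-Link (p ∷ ps) a-sym fzero    fzero    i≢j = contradiction refl i≢j
  Realises-Link (p ∷ ps) a-sym fzero    (fsuc j) i≢j = Pointwise-Link p j
  -- Entries below the diagonal are recovered from those above by symmetry.
  Realises-Link (p ∷ ps) a-sym (fsuc i) fzero    i≢j =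
    subst (λ b → Link G b _ _) (a-sym fzero (fsuc i)) (Pointwise-Link p i ᵒ)
  Realises-Link (p ∷ ps) a-sym (fsuc i) (fsuc j) i≢j =
    Realises-Link ps (λ i j → a-sym (fsuc i) (fsuc j)) i j (i≢j ∘ cong fsuc)

  Realises⇒Contains : ∀ {F xs} → Realises G (adj F) xs → Contains G F
  Realises⇒Contains {F} {xs} r = order F , f , ↔-id _ , same
    where
    inj : ∀ {i j} → lookup xs i ≡ lookup xs j → i ≡ j
    inj {i} {j} eq with i ≟ j
    ... | yes i≡j = i≡j
    ... | no  i≢j = contradiction eq (distinct (Realises-Link r (adj-sym F) i j i≢j))
    f : V F ↣ V G
    f = mk↣ {to = lookup xs} inj
    same : ∀ i j → adj G (lookup xs i) (lookup xs j) ≡ adj F i j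
    same i j with i ≟ j
    ... | yes refl = trans (adj-irrefl G _) (sym (adj-irrefl F i))
    ... | no  i≢j  = adjacency (Realises-Link r (adj-sym F) i j i≢j)

  -- With `vs` the vertices already named, a degree gap not accounted for on `vs` must show at a new
  -- vertex, where the indicators can only be 1 and 0.
  neighbour-outside : ∀ {a b vs} → degree G b < degree G a → Unique vs →
                      sumᴸ (map (𝟙 ∘ adj G a) vs) ≤ sumᴸ (map (𝟙 ∘ adj G b) vs) →
                      ∃[ t ] All (t ≢_) vs × adj G a t ≡ true × adj G b t ≡ false
  neighbour-outside {a} {b} d<d vs! le
    with t , t∉vs , lt ← sum-<⇒∃-<-outside _ _ vs! le
                           (subst₂ _<_ (degree≡sum G b) (degree≡sum G a) d<d)
    with adj G a t in at | adj G b t in bt | lt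
  ... | true  | false | _ = t , t∉vs , at , bt
  ... | true  | true  | s≤s ()
  ... | false | _     | ()

-- Vertices forced by d(w) < d(u) ≤ d(v).

module _ {G : Graph} {v u w : V G} {b : Bool}
         (vw : Link G true v w) (vu : Link G false v u) (uw : Link G b u w)
         (v-max : MaxDegree G v) (dw<du : degree G w < degree G u) where

  private
    v≢w = distinct vw
    v≢u = distinct vu
    u≢w = distinct uw

    wv : adj G w v ≡ true
    wv = adjacency (vw ᵒ)
    wu : adj G w u ≡ b
    wu = adjacency (uw ᵒ)
    uv : adj G u v ≡ false
    uv = adjacency (vu ᵒ)

  -- Among `u`, `w`, `v` the vertex `w` is one neighbour ahead of `u`, through `v`. So outside these
  -- three `u` has at least two more neighbours than `w`.
  U∪UV-element : ∃[ x ] v ≢ x × Link G true u x × Link G false w x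
  U∪UV-element with neighbour-outside {G} {u} {w} {u ∷ w ∷ v ∷ []} dw<du
    ((u≢w ∷ v≢u ∘ sym ∷ []) ∷ (v≢w ∘ sym ∷ []) ∷ [] ∷ []) le
    where
    le : sumᴸ (map (𝟙 ∘ adj G u) (u ∷ w ∷ v ∷ [])) ≤ sumᴸ (map (𝟙 ∘ adj G w) (u ∷ w ∷ v ∷ []))
    le rewrite adj-irrefl G u | adj-irrefl G w | adjacency uw | wu | wv | uv =
      ℕ.+-monoʳ-≤ (𝟙 b) ℕ.z≤n
  ... | x , _ ∷ x≢w ∷ x≢v ∷ [] , ux , wx =
        x , x≢v ∘ sym , adjacent⇒link ux , link (x≢w ∘ sym) wx

  -- Excluding `x` as well only makes the counts on the excluded vertices equal, so the strict
  -- inequality survives outside.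
  U∪UV-element′ : ∀ {x} → v ≢ x → Link G true u x → Link G false w x →
                  ∃[ y ] x ≢ y × v ≢ y × Link G true u y × Link G false w y
  U∪UV-element′ {x} v≢x ux wx with neighbour-outside {G} {u} {w} {u ∷ w ∷ v ∷ x ∷ []} dw<du
    ((u≢w ∷ v≢u ∘ sym ∷ distinct ux ∷ []) ∷ (v≢w ∘ sym ∷ distinct wx ∷ []) ∷ (v≢x ∷ []) ∷ [] ∷ []) le
    where
    le : sumᴸ (map (𝟙 ∘ adj G u) (u ∷ w ∷ v ∷ x ∷ [])) ≤ sumᴸ (map (𝟙 ∘ adj G w) (u ∷ w ∷ v ∷ x ∷ []))
    le rewrite adj-irrefl G u | adj-irrefl G w | adjacency uw | wu | wv | uv
             | adjacency ux | adjacency wx = ℕ.≤-refl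
  ... | y , _ ∷ y≢w ∷ y≢v ∷ y≢x ∷ [] , uy , wy =
        y , y≢x ∘ sym , y≢v ∘ sym , adjacent⇒link uy , link (y≢w ∘ sym) wy

  -- Maximality gives d(v) > d(w), while `v` and `w` have equally many neighbours among themselves.
  V∪UV-element : ∃[ z ] Link G true v z × Link G false w z
  V∪UV-element with neighbour-outside {G} {v} {w} {v ∷ w ∷ []} (ℕ.<-≤-trans dw<du (v-max u)) ((v≢w ∷ []) ∷ [] ∷ []) le
    where
    le : sumᴸ (map (𝟙 ∘ adj G v) (v ∷ w ∷ [])) ≤ sumᴸ (map (𝟙 ∘ adj G w) (v ∷ w ∷ []))
    le rewrite adj-irrefl G v | adj-irrefl G w | adjacency vw | wv = ℕ.≤-refl
  ... | z , _ ∷ z≢w ∷ [] , vz , wz = z , adjacent⇒link vz , link (z≢w ∘ sym) wz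

  -- d(v) ≥ d(x) and d(u) > d(w) together say that d(v) + d(u) exceeds d(x) + d(w), whereas
  -- on {v, u, x, w} the two sums of adjacencies agree.
  excess : ∀ {x} → Link G true v x → Link G true u x → Link G false w x →
           ∃[ t ] All (t ≢_) (v ∷ u ∷ x ∷ w ∷ []) ×
           𝟙 (adj G x t) + 𝟙 (adj G w t) < 𝟙 (adj G v t) + 𝟙 (adj G u t)
  excess {x} vx ux wx = sum-<⇒∃-<-outside _ _ {v ∷ u ∷ x ∷ w ∷ []}
    ((v≢u ∷ distinct vx ∷ v≢w ∷ []) ∷ (distinct ux ∷ u≢w ∷ []) ∷ (distinct (wx ᵒ) ∷ []) ∷ [] ∷ [])
    le (subst₂ _<_ (sum-degrees x w) (sum-degrees v u) (ℕ.+-mono-≤-< (v-max x) dw<du))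
    where
    sum-degrees : ∀ a b → degree G a + degree G b ≡ sum (λ t → 𝟙 (adj G a t) + 𝟙 (adj G b t))
    sum-degrees a b = trans (cong₂ _+_ (degree≡sum G a) (degree≡sum G b))
                            (sym (∑-distrib-+ (𝟙 ∘ adj G a) (𝟙 ∘ adj G b)))
    le : sumᴸ (map (λ t → 𝟙 (adj G v t) + 𝟙 (adj G u t)) (v ∷ u ∷ x ∷ w ∷ [])) ≤
         sumᴸ (map (λ t → 𝟙 (adj G x t) + 𝟙 (adj G w t)) (v ∷ u ∷ x ∷ w ∷ []))
    le rewrite adj-irrefl G v | adj-irrefl G u | adj-irrefl G x | adj-irrefl G w
             | adjacency vu | uv | adjacency vx | adjacency (vx ᵒ) | adjacency ux | adjacency (ux ᵒ)
             | adjacency wx | adjacency (wx ᵒ) | adjacency vw | wv | adjacency uw | wu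
      = ℕ.≤-refl

-- Case analysis over the forbidden subgraphs.

module _ {G : Graph} (free : Forb (_∈ forbidden) G) where

  -- The vertices `xs` are inferred from the rows; the first row alone shows their order, which
  -- follows the labelling of `F`.
  avoid : ∀ {F xs} → F ∈ forbidden → ¬ Realises G (adj F) xs
  avoid {F} F∈ r = free F F∈ (Realises⇒Contains {F = F} r)

  private
    P₅∈ = P₅ ∈ forbidden ∋ here refl
    4-pan∈ = 4-pan ∈ forbidden ∋ there (here refl)
    K₂,₃∈ = K₂,₃ ∈ forbidden ∋ there (there (here refl))
    K₂,₃⁺∈ = K₂,₃⁺ ∈ forbidden ∋ there (there (there (here refl)))
    kite∈ = kite ∈ forbidden ∋ there (there (there (there (here refl))))
    2P₃∈ = 2P₃ ∈ forbidden ∋ there (there (there (there (there (here refl)))))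
    P₃+K₃∈ = P₃+K₃ ∈ forbidden ∋ there (there (there (there (there (there (here refl))))))
    stool∈ = stool ∈ forbidden ∋ there (there (there (there (there (there (there (here refl)))))))
    co-domino∈ = co-domino ∈ forbidden ∋ there (there (there (there (there (there (there (there (here refl))))))))

  module _ {v u w : V G} (vw : Link G true v w) (vu : Link G false v u) where

    module _ {x : V G} (vx : Link G true v x) (ux : Link G true u x) (wx : Link G false w x) where

      -- If `u ≁ w`, then `w` hangs at `v` from the 4-cycle v x u t, which has at most the chord xt.
      -- If `u ~ w`, then u, v against x, t, w form `K₂,₃`, possibly with the edge xt.
      second-common : ∀ {b t} → Link G b u w → Link G true v t → Link G true u t →
                      Link G false w t → x ≢ t → ⊥
      second-common {b} {t} uw vt ut wt x≢t with b | adj G x t in eq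
      ... | false | false = let xt = link x≢t eq in avoid 4-pan∈ (
          (vx ∷ vu ∷ vt ∷ vw ∷ []) ∷
          (ux ᵒ ∷ xt ∷ wx ᵒ ∷ []) ∷
          (ut ∷ uw ∷ []) ∷
          (wt ᵒ ∷ []) ∷
          [] ∷ [])
      ... | false | true  = let xt = link x≢t eq in avoid kite∈ (
          (ux ∷ vu ᵒ ∷ ut ∷ uw ∷ []) ∷
          (vx ᵒ ∷ xt ∷ wx ᵒ ∷ []) ∷
          (vt ∷ vw ∷ []) ∷
          (wt ᵒ ∷ []) ∷
          [] ∷ [])
      ... | true  | false = let xt = link x≢t eq in avoid K₂,₃∈ (
          (vu ᵒ ∷ uw ∷ ux ∷ ut ∷ []) ∷
          (vw ∷ vx ∷ vt ∷ []) ∷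
          (wx ∷ wt ∷ []) ∷
          (xt ∷ []) ∷
          [] ∷ [])
      ... | true  | true  = let xt = link x≢t eq in avoid K₂,₃⁺∈ (
          (vu ᵒ ∷ ux ∷ ut ∷ uw ∷ []) ∷
          (vx ∷ vt ∷ vw ∷ []) ∷
          (xt ∷ wx ᵒ ∷ []) ∷
          (wt ᵒ ∷ []) ∷
          [] ∷ [])

      module _ (uw : Link G false u w) where

        -- Otherwise w v x u y is an induced path.
        U-complete : ∀ {y} → Link G false v y → Link G true u y → Link G false w y → ¬ Link G false x y
        U-complete vy uy wy xy = avoid P₅∈ (
            (vw ᵒ ∷ wx ∷ uw ᵒ ∷ wy ∷ []) ∷
            (vx ∷ vu ∷ vy ∷ []) ∷
            (ux ᵒ ∷ xy ∷ []) ∷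
            (uy ∷ []) ∷
            [] ∷ [])

        module _ {y : V G} (vy : Link G false v y) (uy : Link G true u y)
                 (wy : Link G false w y) (xy : Link G true x y) where

          -- If `y ≁ t`, the triangles y x u and v w t are joined by xv and ut. If `y ~ t`, then x,
          -- t against u, y, v with the edge uy form `K₂,₃⁺`.
          UVW-complete : ∀ {t} → Link G true v t → Link G true u t → Link G true w t → ¬ Link G false x t
          UVW-complete {t} vt ut wt xt with adj G y t in eq
          ... | false = let yt = link (separated vt vy ∘ sym) eq in avoid co-domino∈ (
            (xy ᵒ ∷ uy ᵒ ∷ vy ᵒ ∷ wy ᵒ ∷ yt ∷ []) ∷
            (ux ᵒ ∷ vx ᵒ ∷ wx ᵒ ∷ xt ∷ []) ∷
            (vu ᵒ ∷ uw ∷ ut ∷ []) ∷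
            (vw ∷ vt ∷ []) ∷
            (wt ∷ []) ∷
            [] ∷ [])
          ... | true  = let yt = link (separated vt vy ∘ sym) eq in avoid K₂,₃⁺∈ (
            (xt ∷ ux ᵒ ∷ xy ∷ vx ᵒ ∷ []) ∷
            (ut ᵒ ∷ yt ᵒ ∷ vt ᵒ ∷ []) ∷
            (uy ∷ vu ᵒ ∷ []) ∷
            (vy ᵒ ∷ []) ∷
            [] ∷ [])

          -- If `y ≁ t`, the triangle u x y is joined through `x` to `v` with pendants w, t. If
          -- `y ~ t`, the 4-cycle v x y t has the pendant `w` at `v`.
          V-complete : ∀ {t} → Link G true v t → Link G false u t → Link G false w t → ¬ Link G false x t
          V-complete {t} vt ut wt xt with adj G y t in eq
          ... | false = let yt = link (separated vt vy ∘ sym) eq in avoid stool∈ (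
            (ux ∷ uy ∷ vu ᵒ ∷ uw ∷ ut ∷ []) ∷
            (xy ∷ vx ᵒ ∷ wx ᵒ ∷ xt ∷ []) ∷
            (vy ᵒ ∷ wy ᵒ ∷ yt ∷ []) ∷
            (vw ∷ vt ∷ []) ∷
            (wt ∷ []) ∷
            [] ∷ [])
          ... | true  = let yt = link (separated vt vy ∘ sym) eq in avoid 4-pan∈ (
            (vx ∷ vy ∷ vt ∷ vw ∷ []) ∷
            (xy ∷ xt ∷ wx ᵒ ∷ []) ∷
            (yt ∷ wy ᵒ ∷ []) ∷
            (wt ᵒ ∷ []) ∷
            [] ∷ [])

      module _ (uw : Link G true u w) where

        UVW-complete′ : ∀ {t} → Link G true v t → Link G true u t → Link G true w t → ¬ Link G false x t
        UVW-complete′ vt ut wt xt = avoid K₂,₃⁺∈ (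
            (vu ᵒ ∷ uw ∷ ut ∷ ux ∷ []) ∷
            (vw ∷ vt ∷ vx ∷ []) ∷
            (wt ∷ wx ∷ []) ∷
            (xt ᵒ ∷ []) ∷
            [] ∷ [])

        -- The 4-cycle v w u x has the pendant `t`, at `v` here and at `u` in `U-complete′`.
        V-complete′ : ∀ {t} → Link G true v t → Link G false u t → Link G false w t → ¬ Link G false x t
        V-complete′ vt ut wt xt = avoid 4-pan∈ (
            (vw ∷ vu ∷ vx ∷ vt ∷ []) ∷
            (uw ᵒ ∷ wx ∷ wt ∷ []) ∷
            (ux ∷ ut ∷ []) ∷
            (xt ∷ []) ∷
            [] ∷ [])

        U-complete′ : ∀ {t} → Link G false v t → Link G true u t → Link G false w t → ¬ Link G false x t
        U-complete′ vt ut wt xt = avoid 4-pan∈ (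
            (uw ∷ vu ᵒ ∷ ux ∷ ut ∷ []) ∷
            (vw ᵒ ∷ wx ∷ wt ∷ []) ∷
            (vx ∷ vt ∷ []) ∷
            (xt ∷ []) ∷
            [] ∷ [])

      -- The inequality `lt` confines the excess vertex `t` to UV, UVW, V or U. The first
      -- contradicts `second-common`; in the others `lt` forces `x ≁ t`, against the completeness
      -- hypotheses.
      complete⇒⊥ : ∀ {b} → Link G b u w → MaxDegree G v → degree G w < degree G u →
        (∀ {t} → Link G true v t → Link G true u t → Link G true w t → ¬ Link G false x t) →
        (∀ {t} → Link G true v t → Link G false u t → Link G false w t → ¬ Link G false x t) →
        (∀ {t} → Link G false v t → Link G true u t → Link G false w t → ¬ Link G false x t) → ⊥
      complete⇒⊥ uw v-max dw<du UVW V U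
        with t , t≢v ∷ t≢u ∷ t≢x ∷ t≢w ∷ [] , lt ← excess vw vu uw v-max dw<du vx ux wx
        with v≢t ← t≢v ∘ sym | u≢t ← t≢u ∘ sym | x≢t ← t≢x ∘ sym | w≢t ← t≢w ∘ sym
        with adj G v t in vt | adj G u t in ut | adj G w t in wt | adj G x t in xt | lt
      ... | true  | true  | false | _     | _ =
              second-common uw (link v≢t vt) (link u≢t ut) (link w≢t wt) x≢t
      ... | true  | true  | true  | false | _ = UVW (link v≢t vt) (link u≢t ut) (link w≢t wt) (link x≢t xt)
      ... | true  | false | false | false | _ = V (link v≢t vt) (link u≢t ut) (link w≢t wt) (link x≢t xt)
      ... | false | true  | false | false | _ = U (link v≢t vt) (link u≢t ut) (link w≢t wt) (link x≢t xt)
      ... | true  | true  | true  | true  | s≤s (s≤s ())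
      ... | true  | false | true  | true  | s≤s ()
      ... | true  | false | true  | false | s≤s ()
      ... | true  | false | false | true  | s≤s ()
      ... | false | true  | true  | true  | s≤s ()
      ... | false | true  | true  | false | s≤s ()
      ... | false | true  | false | true  | s≤s ()
      ... | false | false | _     | _     | ()

      no-common : ∀ {b} → Link G b u w → MaxDegree G v → ¬ degree G w < degree G u
      no-common {true} uw v-max dw<du =
        complete⇒⊥ uw v-max dw<du (UVW-complete′ uw) (V-complete′ uw) (U-complete′ uw)
      no-common {false} uw v-max dw<du
        with y , x≢y , v≢y , uy , wy ← U∪UV-element′ vw vu uw v-max dw<du (distinct vx) ux wx
        with adj G v y in vy | adj G x y in xy
      ... | true  | _     = second-common uw (link v≢y vy) uy wy x≢y
      ... | false | false = U-complete uw (link v≢y vy) uy wy (link x≢y xy)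
      ... | false | true  = complete⇒⊥ uw v-max dw<du
            (UVW-complete uw (link v≢y vy) uy wy (link x≢y xy))
            (V-complete uw (link v≢y vy) uy wy (link x≢y xy))
            (U-complete uw)

    -- If `u ≁ w`, an edge from `z` to `x` or `y` yields a path such as u x z v w; otherwise the
    -- path w v z is disjoint from a triangle or path on x, u, y. If `u ~ w`, a missing such edge
    -- yields a path such as x u w v z; otherwise `v` hangs at `z` from the 4-cycle z x u y, with or
    -- without the chord xy.
    no-UUV : ∀ {b x y z} → Link G b u w →
             Link G false v x → Link G true u x → Link G false w x →
             Link G false v y → Link G true u y → Link G false w y → x ≢ y →
             Link G true v z → Link G false u z → Link G false w z → ⊥
    no-UUV {b} {x} {y} {z} uw vx ux wx vy uy wy x≢y vz uz wz
      with b | adj G x z in eq₁ | adj G y z in eq₂ | adj G x y in eq₃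
    ... | false | true  | _     | _     =
        let xz = link (separated vz vx ∘ sym) eq₁
        in avoid P₅∈ (
          (ux ∷ uz ∷ vu ᵒ ∷ uw ∷ []) ∷
          (xz ∷ vx ᵒ ∷ wx ᵒ ∷ []) ∷
          (vz ᵒ ∷ wz ᵒ ∷ []) ∷
          (vw ∷ []) ∷
          [] ∷ [])
    ... | false | false | true  | _     =
        let yz = link (separated vz vy ∘ sym) eq₂
        in avoid P₅∈ (
          (uy ∷ uz ∷ vu ᵒ ∷ uw ∷ []) ∷
          (yz ∷ vy ᵒ ∷ wy ᵒ ∷ []) ∷
          (vz ᵒ ∷ wz ᵒ ∷ []) ∷
          (vw ∷ []) ∷
          [] ∷ [])
    ... | false | false | false | true  =
        let xz = link (separated vz vx ∘ sym) eq₁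
            yz = link (separated vz vy ∘ sym) eq₂
            xy = link x≢y eq₃
        in avoid P₃+K₃∈ (
          (vw ᵒ ∷ wz ∷ uw ᵒ ∷ wx ∷ wy ∷ []) ∷
          (vz ∷ vu ∷ vx ∷ vy ∷ []) ∷
          (uz ᵒ ∷ xz ᵒ ∷ yz ᵒ ∷ []) ∷
          (ux ∷ uy ∷ []) ∷
          (xy ∷ []) ∷
          [] ∷ [])
    ... | false | false | false | false =
        let xz = link (separated vz vx ∘ sym) eq₁
            yz = link (separated vz vy ∘ sym) eq₂
            xy = link x≢y eq₃
        in avoid 2P₃∈ (
          (vw ᵒ ∷ wz ∷ wx ∷ uw ᵒ ∷ wy ∷ []) ∷
          (vz ∷ vx ∷ vu ∷ vy ∷ []) ∷
          (xz ᵒ ∷ uz ᵒ ∷ yz ᵒ ∷ []) ∷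
          (ux ᵒ ∷ xy ∷ []) ∷
          (uy ∷ []) ∷
          [] ∷ [])
    ... | true  | false | _     | _     =
        let xz = link (separated vz vx ∘ sym) eq₁
        in avoid P₅∈ (
          (ux ᵒ ∷ wx ᵒ ∷ vx ᵒ ∷ xz ∷ []) ∷
          (uw ∷ vu ᵒ ∷ uz ∷ []) ∷
          (vw ᵒ ∷ wz ∷ []) ∷
          (vz ∷ []) ∷
          [] ∷ [])
    ... | true  | true  | false | _     =
        let yz = link (separated vz vy ∘ sym) eq₂
        in avoid P₅∈ (
          (uy ᵒ ∷ wy ᵒ ∷ vy ᵒ ∷ yz ∷ []) ∷
          (uw ∷ vu ᵒ ∷ uz ∷ []) ∷
          (vw ᵒ ∷ wz ∷ []) ∷
          (vz ∷ []) ∷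
          [] ∷ [])
    ... | true  | true  | true  | true  =
        let xz = link (separated vz vx ∘ sym) eq₁
            yz = link (separated vz vy ∘ sym) eq₂
            xy = link x≢y eq₃
        in avoid kite∈ (
          (ux ∷ uz ∷ uy ∷ vu ᵒ ∷ []) ∷
          (xz ∷ xy ∷ vx ᵒ ∷ []) ∷
          (yz ᵒ ∷ vz ᵒ ∷ []) ∷
          (vy ᵒ ∷ []) ∷
          [] ∷ [])
    ... | true  | true  | true  | false =
        let xz = link (separated vz vx ∘ sym) eq₁
            yz = link (separated vz vy ∘ sym) eq₂
            xy = link x≢y eq₃
        in avoid 4-pan∈ (
          (xz ᵒ ∷ uz ᵒ ∷ yz ᵒ ∷ vz ᵒ ∷ []) ∷
          (ux ᵒ ∷ xy ∷ vx ᵒ ∷ []) ∷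
          (uy ∷ vu ᵒ ∷ []) ∷
          (vy ᵒ ∷ []) ∷
          [] ∷ [])

    no-deficient-neighbour : u ≢ w → MaxDegree G v → ¬ degree G w < degree G u
    no-deficient-neighbour u≢w v-max dw<du
      -- Here `refl` takes `b` to be `adj G u w` itself, covering both cases at once.
      with x , v≢x , ux , wx ← U∪UV-element vw vu (link u≢w refl) v-max dw<du
      with y , x≢y , v≢y , uy , wy ← U∪UV-element′ vw vu (link u≢w refl) v-max dw<du v≢x ux wx
      with z , vz , wz ← V∪UV-element vw vu (link u≢w refl) v-max dw<du
      with adj G v x in vx | adj G v y in vy | adj G u z in uz
    ... | true  | _     | _     = no-common (link v≢x vx) ux wx (link u≢w refl) v-max dw<du
    ... | false | true  | _     = no-common (link v≢y vy) uy wy (link u≢w refl) v-max dw<du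
    ... | false | false | true  = no-common vz (adjacent⇒link uz) wz (link u≢w refl) v-max dw<du
    ... | false | false | false =
          no-UUV (link u≢w refl) (link v≢x vx) ux wx (link v≢y vy) uy wy x≢y
                 vz (link (separated vz vu ∘ sym) uz) wz

-- Passage to all induced subgraphs.

forb⇒havelHakimi : ∀ {G} → Forb (_∈ forbidden) G → ∀ v → MaxDegree G v → HavelHakimi G v
forb⇒havelHakimi {G} free v v-max = v-max , λ w u v~w u≢v v≁u →
  let vw = adjacent⇒link {G = G} (Equivalence.to T-≡ v~w)
      vu = link (u≢v ∘ sym) (¬-not (v≁u ∘ Equivalence.from T-≡))
  in ℕ.≮⇒≥ (no-deficient-neighbour free vw vu (separated vw vu ∘ sym) v-max)

-- Inducing twice is definitionally inducing along the composite, so `iso` serves unchanged.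
Forb-induced : ∀ {𝓕 G m} (f : Fin m ↣ V G) → Forb 𝓕 G → Forb 𝓕 (induced G f)
Forb-induced f free F F∈ (_ , g , iso) = free F F∈ (_ , f ↣-∘ g , iso)

theorem1 : StrongHavelHakimi ≐ Forb (_∈ forbidden)
theorem1 =
  (λ {G} strong F F∈ → strong⇒¬contains {G} {F} strong (All.lookup forbidden-fail F∈)) ,
  (λ {G} free f → forb⇒havelHakimi {induced G f} (Forb-induced {_∈ forbidden} {G} f free))
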